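{- Let $n\ge 3$, $1\le t<n$, and let $c_1,c_2,\ldots,c_t\in[n]$ be distinct integers such that the sequence $(c_1,\ldots,c_t)$ avoids both patterns $132$ and $231$. If there exist $\alpha\in[n]\setminus\{c_1,\ldots,c_t\}$ and $i,j\in[t]$ with $i<j$ such that $c_i<\alpha<c_j$ or $\alpha<c_i<c_j$, then $|S_{n,(c_1,\ldots,c_t)}(132,231)|=0$; otherwise, $$|S_{n,(c_1,\ldots,c_t)}(132,231)|=2^{\max\{0,\min\{c_1,\ldots,c_t\}-2\}}.$$
   Context: $[n]=\{1,\ldots,n\}$ and $S_n$ is the set of permutations of $[n]$ written as sequences $(\tau(1),\ldots,\tau(n))$. A sequence of distinct integers $\tau=(\tau(1),\ldots,\tau(m))$ contains $\sigma\in S_k$ as a pattern if there are indices $1\le i_1<\cdots<i_k\le m$ such that for all $1\le a<b\le k$, $\tau(i_a)<\tau(i_b)$ if and only if $\sigma(a)<\sigma(b)$; otherwise $\tau$ avoids $\sigma$. $S_{n,(c_1,\ldots,c_t)}(\sigma_1,\ldots,\sigma_m)$ is the set of $\tau\in S_n$ with $(\tau(1),\ldots,\tau(t))=(c_1,\ldots,c_t)$ that avoid all of $\sigma_1,\ldots,\sigma_m$. -}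

module Defs where

open import Data.Fin using (Fin)
import Data.Fin as Fin
open import Data.List using (List; applyUpTo; length)
import Data.List.Membership.Propositional as List
open import Data.List.Relation.Binary.Permutation.Propositional using (_↭_)
open import Data.List.Relation.Binary.Prefix.Heterogeneous using (Prefix)
open import Data.List.Relation.Unary.All using (All)
import Data.List.Relation.Unary.Unique.Propositional as List
open import Data.Nat using (ℕ; suc; _≤_; _<_; _⊓_; NonZero)
open import Data.Product using (Σ; ∃; _×_; _,_)
open import Data.Vec using (Vec; []; _∷_; lookup; toList; foldr₁)
open import Function.Bundles using (_⇔_)
open import Level using (Level)
open import Relation.Binary.PropositionalEquality using (_≡_)
open import Relation.Nullary using (¬_)

-- Entries of sequences are 1-based values in ℕ, as in [n] = {1, …, n};
-- positions in a sequence of length m are elements of Fin m.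

_∈[_] : ℕ → ℕ → Set
x ∈[ n ] = 1 ≤ x × x ≤ n

IsPermutation : ∀ {n} → Vec ℕ n → Set
IsPermutation {n} τ = toList τ ↭ applyUpTo suc n

-- The pattern need not be required to be a permutation for this to make sense,
-- so the definition does not ask for it.
Contains : ∀ {m k} → Vec ℕ m → Vec ℕ k → Set
Contains {m} {k} τ σ =
  Σ (Fin k → Fin m) λ ι →
    (∀ {a b} → a Fin.< b → ι a Fin.< ι b) ×
    (∀ {a b} → a Fin.< b →
       (lookup τ (ι a) < lookup τ (ι b)) ⇔ (lookup σ a < lookup σ b))

Avoids : ∀ {m k} → Vec ℕ m → Vec ℕ k → Set
Avoids τ σ = ¬ Contains τ σ

Pattern : Set
Pattern = ∃ (Vec ℕ)

AvoidsAll : ∀ {m} → Vec ℕ m → List Pattern → Set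
AvoidsAll τ = All λ (_ , σ) → Avoids τ σ

⟨132⟩ ⟨231⟩ : Pattern
⟨132⟩ = 3 , 1 ∷ 3 ∷ 2 ∷ []
⟨231⟩ = 3 , 2 ∷ 3 ∷ 1 ∷ []

-- The set S_{n,(c₁,…,c_t)}(σ₁,…,σ_m), as a predicate on sequences of length n.
S : ∀ n {t} → Vec ℕ t → List Pattern → Vec ℕ n → Set
S n c σs τ = IsPermutation τ × Prefix _≡_ (toList c) (toList τ) × AvoidsAll τ σs

-- The subset of A cut out by P has exactly k elements: some list of length k
-- without repetitions contains exactly the elements satisfying P.
HasCardinality : ∀ {a p : Level} {A : Set a} → (A → Set p) → ℕ → Set _
HasCardinality {A = A} P k =
  Σ (List A) λ xs →
    List.Unique xs × (∀ x → (x List.∈ xs) ⇔ P x) × length xs ≡ k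

minimum : ∀ {t} → .{{NonZero t}} → Vec ℕ t → ℕ
minimum {suc _} = foldr₁ _⊓_

{-# OPTIONS --safe #-}
-- Avoiding 132 and 231 means having no interior peak, so the largest entry n of
-- such a permutation of [n] is its first or its last entry. This drives an
-- induction on n. If c is empty, both positions of n are possible, which doubles
-- the count. If c₁ = n, delete n from both. If n does not occur in c, then n
-- comes last and can be deleted from the permutation. If n = c_j with j > 1, then
-- c₁ < c_j, so any entry missing from c would be an obstruction: c is itself the
-- only permutation, and min c = 1. The empty prefix is thus reached only after deleting c₁ = n
-- from the one-term prefix (n), where n is the minimum of c; it contributes
-- 2 ^ (min c ∸ 2).
module Submission where

open import Defs
open import Data.Fin using (Fin)
import Data.Fin as Fin
open import Data.List using ([]; _∷_)
open import Data.Nat using (ℕ; _≤_; _<_; _∸_; _^_; NonZero)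
open import Data.Product using (Σ-syntax; ∃-syntax; _×_)
open import Data.Sum using (_⊎_)
open import Data.Vec using (Vec; lookup)
open import Data.Vec.Membership.Propositional using (_∉_)
open import Data.Vec.Relation.Unary.All using (All)
open import Data.Vec.Relation.Unary.Unique.Propositional using (Unique)
open import Relation.Nullary using (¬_)

open import Data.Empty using (⊥-elim)
open import Data.Fin using (zero; suc; fromℕ; inject₁; toℕ)
open import Data.Fin.Properties using (toℕ-inject₁; toℕ-fromℕ; toℕ<n)
import Data.Fin.Properties as Fin
open import Data.Fin.Relation.Unary.Top using (view; ‵fromℕ; ‵inject₁)
import Data.List as List
import Data.List.Membership.Propositional as List using (_∈_)
open import Data.List.Membership.Propositional.Properties
  using (∈-map⁺; ∈-map⁻; ∈-++⁺ˡ; ∈-++⁺ʳ; ∈-++⁻; ∈-applyUpTo⁺; ∈-applyUpTo⁻)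
open import Data.List.Membership.Propositional.Properties.WithK using (unique∧set⇒bag)
open import Data.List.Properties using (length-map; length-++; length-applyUpTo; applyUpTo-∷ʳ)
open import Data.List.Relation.Binary.BagAndSetEquality using (∼bag⇒↭)
open import Data.List.Relation.Binary.Permutation.Propositional
  using (_↭_; ↭-refl; ↭-sym; ↭-trans; ↭-reflexive; prep; ↭⇒↭ₛ)
open import Data.List.Relation.Binary.Permutation.Propositional.Properties
  using (∈-resp-↭; ↭-length; drop-∷; ∷↭∷ʳ)
import Data.List.Relation.Binary.Permutation.Setoid.Properties as Permutationₛ
open import Data.List.Relation.Binary.Prefix.Heterogeneous using (Prefix; []; _∷_)
import Data.List.Relation.Unary.All as List using ([]; _∷_)
open import Data.List.Relation.Unary.AllPairs using ([]; _∷_)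
open import Data.List.Relation.Unary.Any using (here; there)
import Data.List.Relation.Unary.Unique.Propositional as List using (Unique)
import Data.List.Relation.Unary.Unique.Propositional.Properties as ListUnique
open import Data.Nat using (zero; suc; _+_; z≤n; s≤s; z<s; s<s; s<s⁻¹; s≤s⁻¹; _≟_)
open import Data.Nat.Properties
open import Data.Product using (_,_; proj₁; proj₂)
open import Data.Sum using (inj₁; inj₂; [_,_]′)
open import Data.Vec using ([]; _∷_; _∷ʳ_; toList; initLast)
open import Data.Vec.Membership.DecPropositional _≟_ using (_∈?_)
open import Data.Vec.Membership.Propositional using (_∈_)
open import Data.Vec.Membership.Propositional.Properties using (∈-lookup; ∈-toList⁺; ∈-toList⁻)
open import Data.Vec.Properties using (toList-∷ʳ; length-toList; ∷ʳ-injectiveˡ)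
open import Data.Vec.Relation.Unary.All as VecAll using ([]; _∷_)
import Data.Vec.Relation.Unary.All.Properties as VecAll
open import Data.Vec.Relation.Unary.AllPairs using ([]; _∷_)
open import Data.Vec.Relation.Unary.Any as VecAny using (here; there)
import Data.Vec.Relation.Unary.Any.Properties as VecAny
open import Data.Vec.Relation.Unary.Unique.Propositional.Properties using (lookup-injective)
open import Function using (_∘_)
open import Function.Bundles using (_⇔_; mk⇔; Equivalence)
open import Relation.Binary.Definitions using (tri<; tri≈; tri>)
open import Relation.Binary.PropositionalEquality
  using (_≡_; _≢_; refl; sym; trans; cong; subst; subst₂; setoid)
open import Relation.Nullary using (yes; no; contradiction)

private
  variable
    A B : Set
    P Q : A → Set
    k l m n t : ℕ

open Equivalence using (to; from)

-- Cardinalities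

card-cong : (∀ x → P x ⇔ Q x) → HasCardinality P k → HasCardinality Q k
card-cong P⇔Q (xs , uniq , xs⇔P , len) =
  xs , uniq , (λ x → mk⇔ (to (P⇔Q x) ∘ to (xs⇔P x)) (from (xs⇔P x) ∘ from (P⇔Q x))) , len

card-empty : (∀ x → ¬ P x) → HasCardinality P 0
card-empty ¬P = [] , [] , (λ x → mk⇔ (λ ()) (⊥-elim ∘ ¬P x)) , refl

card-singleton : ∀ a → P a → (∀ x → P x → x ≡ a) → HasCardinality P 1
card-singleton {P = P} a Pa P⇒≡a =
  a ∷ [] , List.[] ∷ [] ,
  (λ x → mk⇔ (λ { (here x≡a) → subst P (sym x≡a) Pa }) (here ∘ P⇒≡a x)) , refl

Image : (A → B) → (A → Set) → B → Set
Image f P y = ∃[ x ] P x × y ≡ f x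

card-image : {f : A → B} → (∀ {x y} → f x ≡ f y → x ≡ y) →
             HasCardinality P k → HasCardinality (Image f P) k
card-image {f = f} inj (xs , uniq , xs⇔P , len) =
  List.map f xs , ListUnique.map⁺ inj uniq ,
  (λ y → mk⇔
    (λ y∈ → let x , x∈ , y≡ = ∈-map⁻ f y∈ in x , to (xs⇔P x) x∈ , y≡)
    (λ { (x , Px , refl) → ∈-map⁺ f (from (xs⇔P x) Px) })) ,
  trans (length-map f xs) len

card-⊎ : (∀ x → P x → ¬ Q x) → HasCardinality P k → HasCardinality Q l →
         HasCardinality (λ x → P x ⊎ Q x) (k + l)
card-⊎ disj (xs , uxs , xs⇔P , refl) (ys , uys , ys⇔Q , refl) =
  xs List.++ ys ,
  ListUnique.++⁺ uxs uys (λ (x∈xs , x∈ys) → disj _ (to (xs⇔P _) x∈xs) (to (ys⇔Q _) x∈ys)) ,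
  (λ x → mk⇔
    (λ x∈ → [ inj₁ ∘ to (xs⇔P x) , inj₂ ∘ to (ys⇔Q x) ]′ (∈-++⁻ xs x∈))
    [ ∈-++⁺ˡ ∘ from (xs⇔P x) , ∈-++⁺ʳ xs ∘ from (ys⇔Q x) ]′) ,
  length-++ xs

-- Vectors

lookup-∷ʳ-inject₁ : ∀ (xs : Vec A n) x i → lookup (xs ∷ʳ x) (inject₁ i) ≡ lookup xs i
lookup-∷ʳ-inject₁ (y ∷ xs) x zero    = refl
lookup-∷ʳ-inject₁ (y ∷ xs) x (suc i) = lookup-∷ʳ-inject₁ xs x i

lookup-∷ʳ-fromℕ : ∀ (xs : Vec A n) x → lookup (xs ∷ʳ x) (fromℕ n) ≡ x
lookup-∷ʳ-fromℕ []       x = refl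
lookup-∷ʳ-fromℕ (y ∷ xs) x = lookup-∷ʳ-fromℕ xs x

inject₁-mono-< : ∀ {i j : Fin n} → i Fin.< j → inject₁ i Fin.< inject₁ j
inject₁-mono-< {i = i} {j} = subst₂ _<_ (sym (toℕ-inject₁ i)) (sym (toℕ-inject₁ j))

inject₁-cancel-< : ∀ {i j : Fin n} → inject₁ i Fin.< inject₁ j → i Fin.< j
inject₁-cancel-< {i = i} {j} = subst₂ _<_ (toℕ-inject₁ i) (toℕ-inject₁ j)

fromℕ≮ : (i : Fin (suc n)) → ¬ fromℕ n Fin.< i
fromℕ≮ {n} i n<i = <⇒≱ (subst (_< toℕ i) (toℕ-fromℕ n) n<i) (s≤s⁻¹ (toℕ<n i))

toList-unique⁺ : {xs : Vec A n} → Unique xs → List.Unique (toList xs)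
toList-unique⁺ []         = []
toList-unique⁺ (px ∷ pxs) = VecAll.toList⁺ px ∷ toList-unique⁺ pxs

toList-unique⁻ : {xs : Vec A n} → List.Unique (toList xs) → Unique xs
toList-unique⁻ {xs = []}     []         = []
toList-unique⁻ {xs = x ∷ xs} (px ∷ pxs) = VecAll.toList⁻ px ∷ toList-unique⁻ pxs

prefix-∷ʳ⁺ : ∀ {xs} (ys : Vec A n) {y} → Prefix _≡_ xs (toList ys) → Prefix _≡_ xs (toList (ys ∷ʳ y))
prefix-∷ʳ⁺ []       []        = []
prefix-∷ʳ⁺ (_ ∷ ys) []        = []
prefix-∷ʳ⁺ (_ ∷ ys) (e ∷ pre) = e ∷ prefix-∷ʳ⁺ ys pre

-- A prefix reaching the last entry of `ys ∷ʳ y` would have to contain `y`.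
prefix-∷ʳ⁻ : ∀ (xs : Vec A m) (ys : Vec A n) {y} → y ∉ xs →
             Prefix _≡_ (toList xs) (toList (ys ∷ʳ y)) → Prefix _≡_ (toList xs) (toList ys)
prefix-∷ʳ⁻ []       ys       y∉ pre        = []
prefix-∷ʳ⁻ (x ∷ xs) []       y∉ (refl ∷ _) = contradiction (here refl) y∉
prefix-∷ʳ⁻ (x ∷ xs) (_ ∷ ys) y∉ (e ∷ pre)  = e ∷ prefix-∷ʳ⁻ xs ys (y∉ ∘ there) pre

prefix-≡ : (xs ys : Vec A n) → Prefix _≡_ (toList xs) (toList ys) → xs ≡ ys
prefix-≡ []       []       _            = refl
prefix-≡ (x ∷ xs) (y ∷ ys) (refl ∷ pre) = cong (x ∷_) (prefix-≡ xs ys pre)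

prefix-refl : (xs : Vec A n) → Prefix _≡_ (toList xs) (toList xs)
prefix-refl []       = []
prefix-refl (x ∷ xs) = refl ∷ prefix-refl xs

prefix-lookup : (xs : Vec A m) (ys : Vec A n) → Prefix _≡_ (toList xs) (toList ys) → ∀ i →
                ∃[ j ] toℕ j ≡ toℕ i × lookup ys j ≡ lookup xs i
prefix-lookup (x ∷ xs) (y ∷ ys) (e ∷ pre) zero    = zero , refl , sym e
prefix-lookup (x ∷ xs) (y ∷ ys) (e ∷ pre) (suc i) =
  let j , j≡i , eq = prefix-lookup xs ys pre i in suc j , cong suc j≡i , eq

prefix-∈ : (xs : Vec A m) (ys : Vec A n) → Prefix _≡_ (toList xs) (toList ys) →
           ∀ j → toℕ j < m → lookup ys j ∈ xs
prefix-∈ (x ∷ xs) (y ∷ ys) (e ∷ pre) zero    j<m = here (sym e)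
prefix-∈ (x ∷ xs) (y ∷ ys) (e ∷ pre) (suc j) j<m = there (prefix-∈ xs ys pre j (s<s⁻¹ j<m))

-- Permutations of [n]

-- `applyUpTo suc` grows at its right end, so the new maximum is carried across the list from front
-- to back.
perm-∷⁺ : (τ : Vec ℕ n) → IsPermutation τ → IsPermutation (suc n ∷ τ)
perm-∷⁺ {n} τ p =
  ↭-trans (prep (suc n) p) (↭-trans (∷↭∷ʳ (suc n) _) (↭-reflexive (applyUpTo-∷ʳ suc n)))

perm-∷⁻ : (τ : Vec ℕ n) → IsPermutation (suc n ∷ τ) → IsPermutation τ
perm-∷⁻ {n} τ p =
  drop-∷ (↭-trans p (↭-sym (↭-trans (∷↭∷ʳ (suc n) _) (↭-reflexive (applyUpTo-∷ʳ suc n)))))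

∷↭toList-∷ʳ : ∀ x (xs : Vec A n) → x ∷ toList xs ↭ toList (xs ∷ʳ x)
∷↭toList-∷ʳ x xs = ↭-trans (∷↭∷ʳ x (toList xs)) (↭-reflexive (sym (toList-∷ʳ x xs)))

perm-∷ʳ⁺ : (τ : Vec ℕ n) → IsPermutation τ → IsPermutation (τ ∷ʳ suc n)
perm-∷ʳ⁺ {n} τ p = ↭-trans (↭-sym (∷↭toList-∷ʳ (suc n) τ)) (perm-∷⁺ τ p)

perm-∷ʳ⁻ : (τ : Vec ℕ n) → IsPermutation (τ ∷ʳ suc n) → IsPermutation τ
perm-∷ʳ⁻ {n} τ p = perm-∷⁻ τ (↭-trans (∷↭toList-∷ʳ (suc n) τ) p)

perm-∈⁺ : (τ : Vec ℕ n) → IsPermutation τ → k ∈[ n ] → k ∈ τ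
perm-∈⁺ τ p (s≤s _ , k<n) = ∈-toList⁻ (∈-resp-↭ (↭-sym p) (∈-applyUpTo⁺ suc k<n))

perm-∈⁻ : (τ : Vec ℕ n) → IsPermutation τ → k ∈ τ → k ∈[ n ]
perm-∈⁻ τ p k∈ with _ , i<n , refl ← ∈-applyUpTo⁻ suc (∈-resp-↭ p (∈-toList⁺ k∈)) = z<s , i<n

applyUpTo-unique : ∀ n → List.Unique (List.applyUpTo suc n)
applyUpTo-unique n = ListUnique.applyUpTo⁺₁ suc n (λ i<j _ eq → <⇒≢ i<j (suc-injective eq))

perm-unique : (τ : Vec ℕ n) → IsPermutation τ → Unique τ
perm-unique {n} τ p = toList-unique⁻
  (Permutationₛ.Unique-resp-↭ (setoid ℕ) (↭⇒↭ₛ (↭-sym p)) (applyUpTo-unique n))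

-- Between duplicate-free lists, equality as sets is equality as multisets, which is a permutation.
-- That `t` equals `n` is thereby a consequence.
full⇒↭ : (c : Vec ℕ t) → All (_∈[ n ]) c → Unique c → (∀ {α} → α ∈[ n ] → α ∈ c) →
         toList c ↭ List.applyUpTo suc n
full⇒↭ {n = n} c c⊆ uniq ⊆c =
  ∼bag⇒↭ (unique∧set⇒bag (toList-unique⁺ uniq) (applyUpTo-unique n) (mk⇔ ⊆[n] [n]⊆))
  where
  ⊆[n] : ∀ {x} → x List.∈ toList c → x List.∈ List.applyUpTo suc n
  ⊆[n] x∈ with s≤s _ , x≤n ← VecAll.lookup c⊆ (∈-toList⁻ x∈) = ∈-applyUpTo⁺ suc x≤n
  [n]⊆ : ∀ {x} → x List.∈ List.applyUpTo suc n → x List.∈ toList c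
  [n]⊆ x∈ with _ , i<n , refl ← ∈-applyUpTo⁻ suc x∈ = ∈-toList⁺ (⊆c (z<s , i<n))

-- Peaks

-- Plateaux are excluded as well, which makes no difference for distinct entries.
PeakFree : Vec ℕ n → Set
PeakFree τ = ∀ {i j k} → i Fin.< j → j Fin.< k →
  lookup τ i < lookup τ j → lookup τ j < lookup τ k

-- The new front entry can only play the first of the three roles, where it would have to lie below
-- a later entry.
peakFree-∷⁺ : (τ : Vec ℕ n) → (∀ i → lookup τ i ≤ m) → PeakFree τ → PeakFree (m ∷ τ)
peakFree-∷⁺ τ ≤m pf {zero}  {suc j} {suc k} i<j j<k m<τj = contradiction m<τj (≤⇒≯ (≤m j))
peakFree-∷⁺ τ ≤m pf {suc i} {suc j} {suc k} i<j j<k τi<τj = pf (s<s⁻¹ i<j) (s<s⁻¹ j<k) τi<τj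

peakFree-∷⁻ : (τ : Vec ℕ n) → PeakFree (m ∷ τ) → PeakFree τ
peakFree-∷⁻ τ pf i<j j<k = pf (s<s i<j) (s<s j<k)

-- The new last entry can only play the third role, where the inequality to be shown is the bound
-- itself.
peakFree-∷ʳ⁺ : (τ : Vec ℕ n) → (∀ i → lookup τ i < m) → PeakFree τ → PeakFree (τ ∷ʳ m)
peakFree-∷ʳ⁺ {m = m} τ <m pf {i} {j} {k} i<j j<k τi<τj with view i | view j | view k
... | ‵fromℕ | _ | _ = contradiction i<j (fromℕ≮ j)
... | _ | ‵fromℕ | _ = contradiction j<k (fromℕ≮ k)
... | ‵inject₁ _ | ‵inject₁ j′ | ‵fromℕ
  rewrite lookup-∷ʳ-inject₁ τ m j′ | lookup-∷ʳ-fromℕ τ m = <m j′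
... | ‵inject₁ i′ | ‵inject₁ j′ | ‵inject₁ k′
  rewrite lookup-∷ʳ-inject₁ τ m i′ | lookup-∷ʳ-inject₁ τ m j′ | lookup-∷ʳ-inject₁ τ m k′ =
  pf (inject₁-cancel-< i<j) (inject₁-cancel-< j<k) τi<τj

peakFree-∷ʳ⁻ : (τ : Vec ℕ n) → PeakFree (τ ∷ʳ m) → PeakFree τ
peakFree-∷ʳ⁻ {m = m} τ pf {i} {j} {k} i<j j<k τi<τj =
  subst₂ _<_ (lookup-∷ʳ-inject₁ τ m j) (lookup-∷ʳ-inject₁ τ m k)
    (pf (inject₁-mono-< i<j) (inject₁-mono-< j<k)
      (subst₂ _<_ (sym (lookup-∷ʳ-inject₁ τ m i)) (sym (lookup-∷ʳ-inject₁ τ m j)) τi<τj))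

-- Peak-freeness as avoidance of 132 and 231

contains-triple : (τ : Vec ℕ n) (σ : Vec ℕ 3) {i j k : Fin n} → i Fin.< j → j Fin.< k →
  (lookup τ i < lookup τ j ⇔ lookup σ zero < lookup σ (suc zero)) →
  (lookup τ i < lookup τ k ⇔ lookup σ zero < lookup σ (suc (suc zero))) →
  (lookup τ j < lookup τ k ⇔ lookup σ (suc zero) < lookup σ (suc (suc zero))) →
  Contains τ σ
contains-triple τ σ {i} {j} {k} i<j j<k ij ik jk = lookup (i ∷ j ∷ k ∷ []) , mono , same
  where
  mono : ∀ {a b : Fin 3} → a Fin.< b →
         lookup (i ∷ j ∷ k ∷ []) a Fin.< lookup (i ∷ j ∷ k ∷ []) b
  mono {zero}     {suc zero}       _ = i<j
  mono {zero}     {suc (suc zero)} _ = <-trans i<j j<k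
  mono {suc zero} {suc (suc zero)} _ = j<k
  mono {suc zero}       {suc zero}       (s≤s ())
  mono {suc (suc zero)} {suc zero}       (s≤s ())
  mono {suc (suc zero)} {suc (suc zero)} (s≤s (s≤s ()))
  same : ∀ {a b : Fin 3} → a Fin.< b →
         (lookup τ (lookup (i ∷ j ∷ k ∷ []) a) < lookup τ (lookup (i ∷ j ∷ k ∷ []) b))
         ⇔ (lookup σ a < lookup σ b)
  same {zero}     {suc zero}       _ = ij
  same {zero}     {suc (suc zero)} _ = ik
  same {suc zero} {suc (suc zero)} _ = jk
  same {suc zero}       {suc zero}       (s≤s ())
  same {suc (suc zero)} {suc zero}       (s≤s ())
  same {suc (suc zero)} {suc (suc zero)} (s≤s (s≤s ()))

both : A → B → A ⇔ B
both a b = mk⇔ (λ _ → b) (λ _ → a)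

neither : ¬ A → ¬ B → A ⇔ B
neither ¬a ¬b = mk⇔ (⊥-elim ∘ ¬a) (⊥-elim ∘ ¬b)

-- In an ascent followed by a descent, comparing the two outer entries decides which pattern occurs:
-- 132 if the first is smaller, 231 if it is larger. Distinctness excludes ties.
avoids⇒peakFree : (τ : Vec ℕ n) → Unique τ →
                  AvoidsAll τ (⟨132⟩ ∷ ⟨231⟩ ∷ []) → PeakFree τ
avoids⇒peakFree τ uniq (¬132 List.∷ ¬231 List.∷ List.[]) {i} {j} {k} i<j j<k τi<τj
  with <-cmp (lookup τ j) (lookup τ k) | <-cmp (lookup τ i) (lookup τ k)
... | tri< τj<τk _ _ | _ = τj<τk
... | tri≈ _ τj≡τk _ | _ = contradiction (lookup-injective uniq j k τj≡τk) (Fin.<⇒≢ j<k)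
... | tri> τj≮τk _ _ | tri< τi<τk _ _ = contradiction
  (contains-triple τ (1 ∷ 3 ∷ 2 ∷ []) i<j j<k
    (both τi<τj (s<s z<s)) (both τi<τk (s<s z<s)) (neither τj≮τk (λ { (s≤s (s≤s ())) })))
  ¬132
... | tri> _ _ _ | tri≈ _ τi≡τk _ =
  contradiction (lookup-injective uniq i k τi≡τk) (Fin.<⇒≢ (Fin.<-trans i<j j<k))
... | tri> τj≮τk _ _ | tri> τi≮τk _ _ = contradiction
  (contains-triple τ (2 ∷ 3 ∷ 1 ∷ []) i<j j<k
    (both τi<τj (s<s (s<s z<s))) (neither τi≮τk (λ { (s≤s ()) })) (neither τj≮τk (λ { (s≤s ()) })))
  ¬231

-- Both patterns ascend and then descend. Peak-freeness turns the descent of an occurrence into an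
-- ascent, which `same` translates into 3 < 2 or 3 < 1.
peakFree⇒avoids : (τ : Vec ℕ n) → PeakFree τ → AvoidsAll τ (⟨132⟩ ∷ ⟨231⟩ ∷ [])
peakFree⇒avoids τ pf = avoid132 List.∷ avoid231 List.∷ List.[]
  where
  0<1 : zero {2} Fin.< suc {2} zero
  0<1 = z<s
  1<2 : suc {2} zero Fin.< suc {2} (suc zero)
  1<2 = s<s z<s
  avoid132 : Avoids τ (1 ∷ 3 ∷ 2 ∷ [])
  avoid132 (ι , mono , same)
    with s≤s (s≤s ()) ← to (same 1<2) (pf (mono 0<1) (mono 1<2) (from (same 0<1) (s<s z<s)))
  avoid231 : Avoids τ (2 ∷ 3 ∷ 1 ∷ [])
  avoid231 (ι , mono , same)
    with s≤s () ← to (same 1<2) (pf (mono 0<1) (mono 1<2) (from (same 0<1) (s<s (s<s z<s))))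

-- Peak-free permutations

PeakFreePerm : ∀ n → Vec ℕ n → Set
PeakFreePerm n τ = IsPermutation τ × PeakFree τ

PeakFreePermWithPrefix : ∀ n → Vec ℕ t → Vec ℕ n → Set
PeakFreePermWithPrefix n c τ = PeakFreePerm n τ × Prefix _≡_ (toList c) (toList τ)

perm-lookup< : (τ : Vec ℕ n) → IsPermutation τ → ∀ i → lookup τ i < suc n
perm-lookup< τ p i = s≤s (proj₂ (perm-∈⁻ τ p (∈-lookup i τ)))

peakFreePerm-∷⁺ : (τ : Vec ℕ n) → PeakFreePerm n τ → PeakFreePerm (suc n) (suc n ∷ τ)
peakFreePerm-∷⁺ τ (p , pf) = perm-∷⁺ τ p , peakFree-∷⁺ τ (<⇒≤ ∘ perm-lookup< τ p) pf

peakFreePerm-∷⁻ : (τ : Vec ℕ n) → PeakFreePerm (suc n) (suc n ∷ τ) → PeakFreePerm n τ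
peakFreePerm-∷⁻ τ (p , pf) = perm-∷⁻ τ p , peakFree-∷⁻ τ pf

peakFreePerm-∷ʳ⁺ : (τ : Vec ℕ n) → PeakFreePerm n τ → PeakFreePerm (suc n) (τ ∷ʳ suc n)
peakFreePerm-∷ʳ⁺ τ (p , pf) = perm-∷ʳ⁺ τ p , peakFree-∷ʳ⁺ τ (perm-lookup< τ p) pf

peakFreePerm-∷ʳ⁻ : (τ : Vec ℕ n) → PeakFreePerm (suc n) (τ ∷ʳ suc n) → PeakFreePerm n τ
peakFreePerm-∷ʳ⁻ τ (p , pf) = perm-∷ʳ⁻ τ p , peakFree-∷ʳ⁻ τ pf

-- With the maximum strictly inside, the first entry and the maximum form an ascent, so
-- peak-freeness would force the last entry above the maximum.
max-first-or-last : (τ : Vec ℕ (suc n)) → PeakFreePerm (suc n) τ →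
  lookup τ zero ≡ suc n ⊎ lookup τ (fromℕ n) ≡ suc n
max-first-or-last {n} τ (p , pf) with lookup τ zero ≟ suc n | lookup τ (fromℕ n) ≟ suc n
... | yes first≡ | _         = inj₁ first≡
... | no _       | yes last≡ = inj₂ last≡
... | no first≢  | no last≢  = contradiction
  (pf 0<i i<last
    (subst (lookup τ zero <_) M≡ (≤∧≢⇒< (s≤s⁻¹ (perm-lookup< τ p zero)) first≢)))
  (≤⇒≯ (subst (lookup τ (fromℕ n) ≤_) M≡ (s≤s⁻¹ (perm-lookup< τ p (fromℕ n)))))
  where
  M∈ : suc n ∈ τ
  M∈ = perm-∈⁺ τ p (z<s , ≤-refl)
  i = VecAny.index M∈
  M≡ : suc n ≡ lookup τ i
  M≡ = VecAny.lookup-index M∈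
  0<i : zero {n} Fin.< i
  0<i = Fin.≤∧≢⇒< z≤n (λ 0≡i → first≢ (trans (cong (lookup τ) 0≡i) (sym M≡)))
  i<last : i Fin.< fromℕ n
  i<last = Fin.≤∧≢⇒< (Fin.≤fromℕ i) (λ i≡ → last≢ (trans (cong (lookup τ) (sym i≡)) (sym M≡)))

peakFreePerm-suc : (τ : Vec ℕ (suc n)) →
  (Image (suc n ∷_) (PeakFreePerm n) τ ⊎ Image (_∷ʳ suc n) (PeakFreePerm n) τ)
  ⇔ PeakFreePerm (suc n) τ
peakFreePerm-suc {n} τ = mk⇔
  (λ { (inj₁ (τ′ , v , refl)) → peakFreePerm-∷⁺ τ′ v
     ; (inj₂ (τ′ , v , refl)) → peakFreePerm-∷ʳ⁺ τ′ v })
  (split τ)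
  where
  split : ∀ τ → PeakFreePerm (suc n) τ →
          Image (suc n ∷_) (PeakFreePerm n) τ ⊎ Image (_∷ʳ suc n) (PeakFreePerm n) τ
  split τ v with max-first-or-last τ v
  split (_ ∷ τ) v | inj₁ refl = inj₁ (τ , peakFreePerm-∷⁻ τ v , refl)
  split τ v | inj₂ last≡ with initLast τ
  split _ v | inj₂ last≡ | τ , x , refl with refl ← trans (sym (lookup-∷ʳ-fromℕ τ x)) last≡ =
    inj₂ (τ , peakFreePerm-∷ʳ⁻ τ v , refl)

-- Counting

∷-injectiveʳ : ∀ {x} {xs ys : Vec A n} → x ∷ xs ≡ x ∷ ys → xs ≡ ys
∷-injectiveʳ refl = refl

-- `peakFreePerm-suc` doubles the count only from `n = 1` on: both extensions of the empty
-- permutation are the same, so length 1 is a second base case.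
card-peakFreePerm : ∀ n → HasCardinality (PeakFreePerm n) (2 ^ (n ∸ 1))
card-peakFreePerm 0 = card-singleton [] (↭-refl , λ { {()} }) (λ { [] _ → refl })
card-peakFreePerm 1 = card-singleton (1 ∷ []) (↭-refl , λ { {j = zero} () ; {j = suc ()} }) unique
  where
  unique : ∀ τ → PeakFreePerm 1 τ → τ ≡ 1 ∷ []
  unique τ@(x ∷ []) (p , _) with here refl ← perm-∈⁺ τ p (≤-refl , ≤-refl) = refl
card-peakFreePerm (suc (suc n)) = card-cong peakFreePerm-suc
  -- `2 ^ suc n` unfolds to `2 ^ n + (2 ^ n + 0)`.
  (subst (HasCardinality _) (cong (2 ^ n +_) (sym (+-identityʳ (2 ^ n))))
    (card-⊎ disjoint
      (card-image ∷-injectiveʳ (card-peakFreePerm (suc n)))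
      (card-image (∷ʳ-injectiveˡ _ _) (card-peakFreePerm (suc n)))))
  where
  disjoint : ∀ τ → Image (suc (suc n) ∷_) (PeakFreePerm (suc n)) τ →
             ¬ Image (_∷ʳ suc (suc n)) (PeakFreePerm (suc n)) τ
  -- Lying in both images would make `suc (suc n)` the first entry of a permutation of `[suc n]`.
  disjoint _ (_ , _ , refl) (τ@(_ ∷ _) , (p , _) , refl) = <-irrefl refl (perm-lookup< τ p zero)

peakFreePermWithPrefix-∷ : ∀ (c : Vec ℕ t) τ →
  Image (suc n ∷_) (PeakFreePermWithPrefix n c) τ ⇔ PeakFreePermWithPrefix (suc n) (suc n ∷ c) τ
peakFreePermWithPrefix-∷ c τ = mk⇔
  (λ { (τ′ , (v , pre) , refl) → peakFreePerm-∷⁺ τ′ v , refl ∷ pre })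
  (extract τ)
  where
  extract : ∀ τ → PeakFreePermWithPrefix (suc n) (suc n ∷ c) τ →
            Image (suc n ∷_) (PeakFreePermWithPrefix n c) τ
  extract (_ ∷ τ) (v , refl ∷ pre) = τ , (peakFreePerm-∷⁻ τ v , pre) , refl

-- The prefix has a head `d` other than the maximum, so the maximum cannot come first. It comes
-- last, and deleting it leaves the prefix intact.
peakFreePermWithPrefix-∷ʳ : ∀ {d} (c : Vec ℕ t) → suc n ∉ d ∷ c → ∀ τ →
  Image (_∷ʳ suc n) (PeakFreePermWithPrefix n (d ∷ c)) τ ⇔ PeakFreePermWithPrefix (suc n) (d ∷ c) τ
peakFreePermWithPrefix-∷ʳ {n = n} {d} c M∉ τ = mk⇔
  (λ { (τ′ , (v , pre) , refl) → peakFreePerm-∷ʳ⁺ τ′ v , prefix-∷ʳ⁺ τ′ pre })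
  extract
  where
  extract : PeakFreePermWithPrefix (suc n) (d ∷ c) τ →
            Image (_∷ʳ suc n) (PeakFreePermWithPrefix n (d ∷ c)) τ
  extract (v , pre) with from (peakFreePerm-suc τ) v
  extract (v , refl ∷ _) | inj₁ (_ , _ , refl) = contradiction (here refl) M∉
  extract (v , pre) | inj₂ (τ′ , v′ , refl) = τ′ , (v′ , prefix-∷ʳ⁻ (d ∷ c) τ′ M∉ pre) , refl

card-full-prefix : (c : Vec ℕ t) → toList c ↭ List.applyUpTo suc n → PeakFree c →
                   HasCardinality (PeakFreePermWithPrefix n c) 1
card-full-prefix {n = n} c p pf
  -- Comparing lengths identifies `t` with `n`, so that `c` itself has the type of a candidate.
  with refl ← trans (sym (length-toList c)) (trans (↭-length p) (length-applyUpTo suc n)) =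
  card-singleton {P = PeakFreePermWithPrefix n c} c ((p , pf) , prefix-refl c) (λ τ (_ , pre) → sym (prefix-≡ c τ pre))

-- The two alternatives of the theorem together say `c_i < c_j` and `α < c_j`, since `α = c_i` is
-- impossible for a missing `α`. This is the negation, put positively: missing values lie above
-- every ascent.
Unobstructed : ℕ → Vec ℕ t → Set
Unobstructed n c = ∀ {α} → α ∈[ n ] → α ∉ c →
  ∀ {i j} → i Fin.< j → lookup c i < lookup c j → lookup c j ≤ α

unobstructed-pred : (c : Vec ℕ t) → Unobstructed (suc n) c → Unobstructed n c
unobstructed-pred c unob (1≤α , α≤n) = unob (1≤α , m≤n⇒m≤1+n α≤n)

unobstructed-tail : (c : Vec ℕ t) → Unobstructed (suc n) (suc n ∷ c) → Unobstructed n c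
unobstructed-tail c unob (1≤α , α≤n) α∉c i<j =
  unob (1≤α , m≤n⇒m≤1+n α≤n)
    (λ { (here refl) → <-irrefl refl α≤n ; (there α∈c) → α∉c α∈c }) (s<s i<j)

-- The head `d` and the maximum form an ascent, so a missing value would be at least the maximum,
-- hence equal to it; but the maximum is present.
unobstructed⇒full : ∀ {d} (c : Vec ℕ t) → d < suc n → suc n ∈ c → Unobstructed (suc n) (d ∷ c) →
                    ∀ {α} → α ∈[ suc n ] → α ∈ d ∷ c
unobstructed⇒full {n = n} {d} c d<M M∈c unob {α} α∈[M] with α ∈? (d ∷ c)
... | yes α∈ = α∈
... | no α∉ = contradiction (there (subst (_∈ c) (≤-antisym M≤α (proj₂ α∈[M])) M∈c)) α∉
  where
  M≡ = VecAny.lookup-index M∈c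
  M≤α : suc n ≤ α
  M≤α = subst (_≤ α) (sym M≡)
    (unob α∈[M] α∉ {zero} {suc (VecAny.index M∈c)} z<s (subst (d <_) M≡ d<M))

∈[]-pred : (c : Vec ℕ t) → suc n ∉ c → All (_∈[ suc n ]) c → All (_∈[ n ]) c
∈[]-pred []      M∉ []                  = []
∈[]-pred (x ∷ c) M∉ ((1≤x , x≤M) ∷ c⊆) =
  (1≤x , s≤s⁻¹ (≤∧≢⇒< x≤M (λ x≡M → M∉ (here (sym x≡M))))) ∷ ∈[]-pred c (M∉ ∘ there) c⊆

-- The minimum is a parameter `m` given by membership and lower bound, so it passes unchanged to
-- shorter prefixes. Membership also rules out the empty prefix.
card-peakFreePermWithPrefix : ∀ n (c : Vec ℕ t) → m ∈ c → All (m ≤_) c →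
  All (_∈[ n ]) c → Unique c → PeakFree c → Unobstructed n c →
  HasCardinality (PeakFreePermWithPrefix n c) (2 ^ (m ∸ 2))
card-peakFreePermWithPrefix zero c m∈ _ c⊆ _ _ _
  with 1≤m , m≤0 ← VecAll.lookup c⊆ m∈ = contradiction 1≤m (≤⇒≯ m≤0)
card-peakFreePermWithPrefix {m = m} (suc n) (d ∷ c) m∈ m≤ c⊆@(d∈ ∷ c⊆′) uniq@(d≢ ∷ uniq′) pf unob
  with d ≟ suc n | suc n ∈? c
... | yes refl | _ =
  card-cong (peakFreePermWithPrefix-∷ c) (card-image ∷-injectiveʳ (rest c m∈ m≤ c⊆′ d≢ uniq′ pf unob))
  where
  rest : (c : Vec ℕ k) → m ∈ suc n ∷ c → All (m ≤_) (suc n ∷ c) → All (_∈[ suc n ]) c →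
         All (suc n ≢_) c → Unique c → PeakFree (suc n ∷ c) → Unobstructed (suc n) (suc n ∷ c) →
         HasCardinality (PeakFreePermWithPrefix n c) (2 ^ (m ∸ 2))
  -- Here `m` is `suc n`, so `m ∸ 2` reduces to the exponent `n ∸ 1` of the unrestricted count.
  rest [] (here refl) _ _ _ _ _ _ = card-cong (λ _ → mk⇔ (_, []) proj₁) (card-peakFreePerm n)
  -- If the minimum is `suc n`, any second term is squeezed to the same value, against distinctness.
  rest (e ∷ _) (here refl) (_ ∷ m≤e ∷ _) ((_ , e≤M) ∷ _) (M≢e ∷ _) _ _ _ =
    contradiction (≤-antisym m≤e e≤M) M≢e
  rest c (there m∈) (_ ∷ m≤) c⊆ M≢ uniq pf unob =
    card-peakFreePermWithPrefix n c m∈ m≤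
      (∈[]-pred c (λ M∈ → VecAll.lookup M≢ M∈ refl) c⊆) uniq (peakFree-∷⁻ c pf)
      (unobstructed-tail c unob)
... | no d≢M | yes M∈ =
  subst (λ e → HasCardinality (PeakFreePermWithPrefix (suc n) (d ∷ c)) (2 ^ e)) (sym m∸2≡0)
    (card-full-prefix (d ∷ c) (full⇒↭ (d ∷ c) c⊆ uniq full) pf)
  where
  full : ∀ {α} → α ∈[ suc n ] → α ∈ d ∷ c
  full = unobstructed⇒full c (≤∧≢⇒< (proj₂ d∈) d≢M) M∈ unob
  m∸2≡0 : m ∸ 2 ≡ 0
  -- The full prefix contains 1, so `m ≤ 1` and the exponent truncates to 0.
  m∸2≡0 = m≤n⇒m∸n≡0 (m≤n⇒m≤1+n (VecAll.lookup m≤ (full (≤-refl , z<s))))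
... | no d≢M | no M∉c =
  card-cong (peakFreePermWithPrefix-∷ʳ c M∉)
    (card-image (∷ʳ-injectiveˡ _ _)
      (card-peakFreePermWithPrefix n (d ∷ c) m∈ m≤ (∈[]-pred (d ∷ c) M∉ c⊆) uniq pf
        (unobstructed-pred (d ∷ c) unob)))
  where
  M∉ : suc n ∉ d ∷ c
  M∉ (here M≡d) = d≢M (sym M≡d)
  M∉ (there M∈) = M∉c M∈

-- The minimum of the prefix, obstructed prefixes and the final count

minimum-∈ : (x : ℕ) (c : Vec ℕ t) → minimum (x ∷ c) ∈ x ∷ c
minimum-∈ x []      = here refl
minimum-∈ x (y ∷ c) with ⊓-sel x (minimum (y ∷ c))
... | inj₁ ≡x = here ≡x
... | inj₂ ≡m = there (subst (_∈ y ∷ c) (sym ≡m) (minimum-∈ y c))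

minimum-≤ : (x : ℕ) (c : Vec ℕ t) → All (minimum (x ∷ c) ≤_) (x ∷ c)
minimum-≤ x []      = ≤-refl ∷ []
minimum-≤ x (y ∷ c) =
  m⊓n≤m x _ ∷ VecAll.map (≤-trans (m⊓n≤n x (minimum (y ∷ c)))) (minimum-≤ y c)

-- A value missing from `c` occurs in `τ` only after the whole prefix, hence after the ascent from
-- `c_i` to `c_j`. Being below `c_j`, it makes `c_j` a peak.
obstruction-peak : (c : Vec ℕ t) {α : ℕ} → α ∈[ n ] → α ∉ c → ∀ {i j} → i Fin.< j →
  lookup c i < lookup c j → α < lookup c j → ∀ τ → ¬ PeakFreePermWithPrefix n c τ
obstruction-peak c {α} α∈ α∉c {i} {j} i<j ci<cj α<cj τ ((p , pf) , pre)
  with i′ , i′≡i , τi′≡ ← prefix-lookup c τ pre i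
     | j′ , j′≡j , τj′≡ ← prefix-lookup c τ pre j =
  <⇒≯ α<cj (subst₂ _<_ τj′≡ (sym α≡)
    (pf (subst₂ _<_ (sym i′≡i) (sym j′≡j) i<j)
        (<-≤-trans (subst (_< _) (sym j′≡j) (toℕ<n j)) t≤k)
        (subst₂ _<_ (sym τi′≡) (sym τj′≡) ci<cj)))
  where
  α∈τ = perm-∈⁺ τ p α∈
  α≡ = VecAny.lookup-index α∈τ
  -- Positions count from 0, so those below the length of `c` are exactly the ones the prefix fills.
  t≤k = ≮⇒≥ (λ k<t → α∉c (subst (_∈ c) (sym α≡) (prefix-∈ c τ pre (VecAny.index α∈τ) k<t)))

peakFreePermWithPrefix⇔S : ∀ n (c : Vec ℕ t) τ →
  PeakFreePermWithPrefix n c τ ⇔ S n c (⟨132⟩ ∷ ⟨231⟩ ∷ []) τ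
peakFreePermWithPrefix⇔S n c τ = mk⇔
  (λ ((p , pf) , pre) → p , pre , peakFree⇒avoids τ pf)
  (λ (p , pre , avoids) → (p , avoids⇒peakFree τ (perm-unique τ p) avoids) , pre)

theorem5p7 : (n t : ℕ) .{{_ : NonZero t}} → 3 ≤ n → t < n →
    (c : Vec ℕ t) → All (_∈[ n ]) c → Unique c →
    AvoidsAll c (⟨132⟩ ∷ ⟨231⟩ ∷ []) →
    let Obstructed = ∃[ α ] α ∈[ n ] × α ∉ c × (Σ[ i ∈ Fin t ] Σ[ j ∈ Fin t ] i Fin.< j × ((lookup c i < α × α < lookup c j) ⊎ (α < lookup c i × lookup c i < lookup c j)))
    in (Obstructed → HasCardinality (S n c (⟨132⟩ ∷ ⟨231⟩ ∷ [])) 0)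
    × (¬ Obstructed → HasCardinality (S n c (⟨132⟩ ∷ ⟨231⟩ ∷ [])) (2 ^ (minimum c ∸ 2)))
theorem5p7 n (suc t) _ _ c@(d ∷ c′) c⊆ uniq avoids = obstructed , unobstructed
  where
  obstructed : _
  obstructed (α , α∈ , α∉ , i , j , i<j , between) =
    card-cong (peakFreePermWithPrefix⇔S n c) (card-empty
      -- Transitivity supplies the ascent in the first alternative and `α < c_j` in the second.
      ([ (λ (ci<α , α<cj) → obstruction-peak c α∈ α∉ i<j (<-trans ci<α α<cj) α<cj)
       , (λ (α<ci , ci<cj) → obstruction-peak c α∈ α∉ i<j ci<cj (<-trans α<ci ci<cj))
       ]′ between))

  unobstructed : _
  unobstructed ¬obs = card-cong (peakFreePermWithPrefix⇔S n c)
    (card-peakFreePermWithPrefix n c (minimum-∈ d c′) (minimum-≤ d c′) c⊆ uniq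
      (avoids⇒peakFree c uniq avoids) unob)
    where
    unob : Unobstructed n c
    unob {α} α∈ α∉ {i} {j} i<j ci<cj = ≮⇒≥ λ α<cj → ¬obs (α , α∈ , α∉ , i , j , i<j , side α<cj)
      where
      side : α < lookup c j → (lookup c i < α × α < lookup c j) ⊎ (α < lookup c i × lookup c i < lookup c j)
      side α<cj with <-cmp (lookup c i) α
      ... | tri< ci<α _ _ = inj₁ (ci<α , α<cj)
      ... | tri≈ _ refl _ = contradiction (∈-lookup i c) α∉
      ... | tri> _ _ α<ci = inj₂ (α<ci , ci<cj)
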